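{- The calculus RT is cut-free complete for reflexive models: for every hypersequent $H$, if no model based on a reflexive frame is a counter-example to $H$, then $H$ has a derivation in RT that does not use the Cut rule.
   Context: **Language.** Modal formulas are built from propositional variables by $\lnot,\land,\Box$. A frame is $\langle W,R\rangle$ with $W\neq\emptyset$, $R\subseteq W\times W$; a model $\mathfrak M=\langle W,R,V\rangle$ adds a valuation, and truth $\mathfrak M,w\models\varphi$ is the usual Kripke truth definition ($\Box\varphi$ is true at $w$ iff $\varphi$ is true at every $v$ with $wRv$). **Hypersequents.** A sequent is an expression $\Gamma\Rightarrow\Delta$ with $\Gamma,\Delta$ finite sets of formulas (written as comma-separated lists; $\varphi,\Gamma$ means $\{\varphi\}\cup\Gamma$, and $\varphi\in\Gamma$ is allowed). A hypersequent is a finite nonempty sequence of sequents $S_1\;/\!/\;\dots\;/\!/\; S_n$ (order and multiplicity matter). **Semantics.** $\mathfrak M$ is a countermodel to $\Gamma\Rightarrow\Delta$ at $w$ iff $\mathfrak M,w\models\varphi$ for all $\varphi\in\Gamma$ and $\mathfrak M,w\not\models\psi$ for all $\psi\in\Delta$. $\mathfrak M$ is a counter-example to $\Gamma_1\Rightarrow\Delta_1\;/\!/\;\dots\;/\!/\;\Gamma_n\Rightarrow\Delta_n$ iff there are worlds $w_1,\dots,w_n$ with $w_iRw_{i+1}$ for $1\le i<n$ such that $\mathfrak M$ is a countermodel to $\Gamma_i\Rightarrow\Delta_i$ at $w_i$ for every $i$. **The calculus RK.** Derivations are finite trees of hypersequents whose leaves are axioms $\varphi\Rightarrow\varphi$ (one-component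 hypersequents) and which are built by the following rules. Here $G,H$ are possibly empty sequences of sequents unless otherwise said; "premise(s) / conclusion". - WL: $G\;/\!/\;\Gamma\Rightarrow\Delta\;/\!/\; H$ / $G\;/\!/\;\varphi,\Gamma\Rightarrow\Delta\;/\!/\; H$. - WR: $G\;/\!/\;\Gamma\Rightarrow\Delta\;/\!/\; H$ / $G\;/\!/\;\Gamma\Rightarrow\Delta,\varphi\;/\!/\; H$. - Cut: $G\;/\!/\;\Gamma\Rightarrow\Delta,\varphi\;/\!/\; H$ and $G\;/\!/\;\varphi,\Lambda\Rightarrow\Theta\;/\!/\; H$ / $G\;/\!/\;\Gamma,\Lambda\Rightarrow\Delta,\Theta\;/\!/\; H$. - EWR: $G$ / $G\;/\!/\;\ \Rightarrow\ $ ($G$ a hypersequent; an empty sequent is appended on the right). - EWL: $G$ / $\ \Rightarrow\ \;/\!/\; G$ ($G$ a hypersequent; an empty sequent is prepended on the left). - $\lnot$L: $G\;/\!/\;\Gamma\Rightarrow\Delta,\varphi\;/\!/\; H$ / $G\;/\!/\;\lnot\varphi,\Gamma\Rightarrow\Delta\;/\!/\; H$. - $\lnot$R: $G\;/\!/\;\varphi,\Gamma\Rightarrow\Delta\;/\!/\; H$ / $G\;/\!/\;\Gamma\Rightarrow\Delta,\lnot\varphi\;/\!/\; H$. - $\land$L$_1$: $G\;/\!/\;\varphi,\Gamma\Rightarrow\Delta\;/\!/\; H$ / $G\;/\!/\;\varphi\land\psi,\Gamma\Rightarrow\Delta\;/\!/\; H$. - $\land$L$_2$: $G\;/\!/\;\psi,\Gamma\Rightarrow\Delta\;/\!/\;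 H$ / $G\;/\!/\;\varphi\land\psi,\Gamma\Rightarrow\Delta\;/\!/\; H$. - $\land$R: $G\;/\!/\;\Gamma\Rightarrow\Delta,\varphi\;/\!/\; H$ and $G\;/\!/\;\Gamma\Rightarrow\Delta,\psi\;/\!/\; H$ / $G\;/\!/\;\Gamma\Rightarrow\Delta,\varphi\land\psi\;/\!/\; H$. - $\Box$L: $G\;/\!/\;\Gamma\Rightarrow\Delta\;/\!/\;\varphi,\Lambda\Rightarrow\Theta\;/\!/\; H$ / $G\;/\!/\;\Box\varphi,\Gamma\Rightarrow\Delta\;/\!/\;\Lambda\Rightarrow\Theta\;/\!/\; H$. - $\Box$R: $H\;/\!/\;\Gamma\Rightarrow\Delta\;/\!/\;\ \Rightarrow\varphi$ / $H\;/\!/\;\Gamma\Rightarrow\Delta,\Box\varphi$ (the active components are rightmost). **The calculus RT** is RK together with external contraction EC: $G\;/\!/\;\Gamma\Rightarrow\Delta\;/\!/\;\Gamma\Rightarrow\Delta\;/\!/\; H$ / $G\;/\!/\;\Gamma\Rightarrow\Delta\;/\!/\; H$. -}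

module Defs where

open import Data.Empty using (⊥)
open import Data.List.Base using (List; []; _∷_; [_]; _++_)
open import Data.List.NonEmpty using (List⁺; _∷_; _∷⁺_; _++⁺_; _⁺++_; toList)
open import Data.List.Relation.Binary.BagAndSetEquality using (_∼[_]_; set)
open import Data.List.Relation.Binary.Pointwise.Base using (Pointwise)
open import Data.List.Relation.Unary.All using (All; []; _∷_)
open import Data.List.Relation.Unary.Linked using (Linked)
open import Data.Nat.Base using (ℕ)
open import Data.Product.Base using (∃-syntax; _×_)
open import Data.Unit.Base using (⊤)
open import Relation.Binary.Core using (Rel)
open import Relation.Binary.Definitions using (Reflexive)
open import Relation.Nullary.Negation.Core using (¬_)

infix  9 ~_ □_
infixr 8 _∧_
infix  4 _⇒_
infix  4 _≈ˢ_ _≈ʰ_ _,_⊨_ _,_⊭_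

data Formula : Set where
  var : ℕ → Formula
  ~_  : Formula → Formula
  _∧_ : Formula → Formula → Formula
  □_  : Formula → Formula

record Frame : Set₁ where
  field
    World     : Set
    inhabited : World
    _⟶_       : Rel World _

record Model : Set₁ where
  field
    frame : Frame
  open Frame frame public
  field
    valuation : ℕ → World → Set

ReflexiveFrame : Frame → Set
ReflexiveFrame F = Reflexive (Frame._⟶_ F)

_,_⊨_ : (M : Model) → Model.World M → Formula → Set
M , w ⊨ var p   = Model.valuation M p w
M , w ⊨ ~ φ     = ¬ (M , w ⊨ φ)
M , w ⊨ φ ∧ ψ   = (M , w ⊨ φ) × (M , w ⊨ ψ)
M , w ⊨ □ φ     = ∀ v → Model._⟶_ M w v → M , v ⊨ φ

_,_⊭_ : (M : Model) → Model.World M → Formula → Set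
M , w ⊭ φ = ¬ (M , w ⊨ φ)

-- The lists on either side stand for finite sets: order and multiplicity
-- within a sequent are disregarded via _≈ˢ_, the equality of sequents.
-- Accordingly φ ∷ Γ is both "φ, Γ" and "Γ, φ", and ++ is union.
record Sequent : Set where
  constructor _⇒_
  field
    antecedent : List Formula
    succedent  : List Formula

record _≈ˢ_ (S T : Sequent) : Set where
  field
    antecedent-≈ : Sequent.antecedent S ∼[ set ] Sequent.antecedent T
    succedent-≈  : Sequent.succedent S ∼[ set ] Sequent.succedent T

Hypersequent : Set
Hypersequent = List⁺ Sequent

-- Order and multiplicity of the components do matter.
_≈ʰ_ : Rel Hypersequent _
G ≈ʰ H = Pointwise _≈ˢ_ (toList G) (toList H)

IsCountermodel : (M : Model) → Model.World M → Sequent → Set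
IsCountermodel M w (Γ ⇒ Δ) = All (M , w ⊨_) Γ × All (M , w ⊭_) Δ

IsCounterExample : Model → Hypersequent → Set
IsCounterExample M H =
  ∃[ ws ] Linked (Model._⟶_ M) ws × Pointwise (IsCountermodel M) ws (toList H)

-- A calculus is given by its inferences (list of premises, conclusion);
-- axioms are inferences without premises.
Calculus : Set₁
Calculus = List Hypersequent → Hypersequent → Set

data RK : Calculus where
  Ax  : ∀ φ → RK [] (([ φ ] ⇒ [ φ ]) ∷ [])
  WL  : ∀ G H Γ Δ φ →
        RK [ G ++⁺ ((Γ ⇒ Δ) ∷ H) ]
           (G ++⁺ ((φ ∷ Γ ⇒ Δ) ∷ H))
  WR  : ∀ G H Γ Δ φ →
        RK [ G ++⁺ ((Γ ⇒ Δ) ∷ H) ]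
           (G ++⁺ ((Γ ⇒ φ ∷ Δ) ∷ H))
  Cut : ∀ G H Γ Δ Λ Θ φ →
        RK ((G ++⁺ ((Γ ⇒ φ ∷ Δ) ∷ H)) ∷ (G ++⁺ ((φ ∷ Λ ⇒ Θ) ∷ H)) ∷ [])
           (G ++⁺ ((Γ ++ Λ ⇒ Δ ++ Θ) ∷ H))
  EWR : ∀ (G : Hypersequent) → RK [ G ] (G ⁺++ [ [] ⇒ [] ])
  EWL : ∀ (G : Hypersequent) → RK [ G ] (([] ⇒ []) ∷⁺ G)
  ¬L  : ∀ G H Γ Δ φ →
        RK [ G ++⁺ ((Γ ⇒ φ ∷ Δ) ∷ H) ]
           (G ++⁺ ((~ φ ∷ Γ ⇒ Δ) ∷ H))
  ¬R  : ∀ G H Γ Δ φ →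
        RK [ G ++⁺ ((φ ∷ Γ ⇒ Δ) ∷ H) ]
           (G ++⁺ ((Γ ⇒ ~ φ ∷ Δ) ∷ H))
  ∧L₁ : ∀ G H Γ Δ φ ψ →
        RK [ G ++⁺ ((φ ∷ Γ ⇒ Δ) ∷ H) ]
           (G ++⁺ ((φ ∧ ψ ∷ Γ ⇒ Δ) ∷ H))
  ∧L₂ : ∀ G H Γ Δ φ ψ →
        RK [ G ++⁺ ((ψ ∷ Γ ⇒ Δ) ∷ H) ]
           (G ++⁺ ((φ ∧ ψ ∷ Γ ⇒ Δ) ∷ H))
  ∧R  : ∀ G H Γ Δ φ ψ →
        RK ((G ++⁺ ((Γ ⇒ φ ∷ Δ) ∷ H)) ∷ (G ++⁺ ((Γ ⇒ ψ ∷ Δ) ∷ H)) ∷ [])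
           (G ++⁺ ((Γ ⇒ φ ∧ ψ ∷ Δ) ∷ H))
  □L  : ∀ G H Γ Δ Λ Θ φ →
        RK [ G ++⁺ ((Γ ⇒ Δ) ∷ (φ ∷ Λ ⇒ Θ) ∷ H) ]
           (G ++⁺ ((□ φ ∷ Γ ⇒ Δ) ∷ (Λ ⇒ Θ) ∷ H))
  □R  : ∀ H Γ Δ φ →
        RK [ H ++⁺ ((Γ ⇒ Δ) ∷ [ [] ⇒ [ φ ] ]) ]
           (H ++⁺ ((Γ ⇒ □ φ ∷ Δ) ∷ []))

data RT : Calculus where
  rk : ∀ {Ps C} → RK Ps C → RT Ps C
  EC : ∀ G H Γ Δ →
       RT [ G ++⁺ ((Γ ⇒ Δ) ∷ (Γ ⇒ Δ) ∷ H) ]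
          (G ++⁺ ((Γ ⇒ Δ) ∷ H))

-- The conclusion of each inference is read up to _≈ʰ_, since sequents
-- consist of sets of formulas.
data Derivation (𝓒 : Calculus) : Hypersequent → Set where
  infer : ∀ {Ps C H} → 𝓒 Ps C → All (Derivation 𝓒) Ps → C ≈ʰ H → Derivation 𝓒 H

IsCut : ∀ {Ps C} → RT Ps C → Set
IsCut (rk (Cut _ _ _ _ _ _ _)) = ⊤
IsCut _                        = ⊥

mutual
  CutFree : ∀ {H} → Derivation RT H → Set
  CutFree (infer r ds _) = ¬ IsCut r × AllCutFree ds

  AllCutFree : ∀ {Hs} → All (Derivation RT) Hs → Set
  AllCutFree []       = ⊤
  AllCutFree (d ∷ ds) = CutFree d × AllCutFree ds

{-# OPTIONS --safe #-}
-- Information only flows from left to right in a hypersequent, so all rules are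
-- applied to the leftmost component alone.  It is first saturated; EC together
-- with □L, EWL and weakening makes φ available next to □ φ there.  A saturated
-- leftmost component that is not closed by an axiom can then be discarded
-- after copying the φ with □ φ in its antecedent to its successor, which is
-- either the next component or, for each □ ψ in its succedent, the new sequent
-- ⇒ ψ of □R; in the latter case the modal depth drops.  This either yields a
-- derivation or leaves a path of saturated sequents; those are the worlds of a
-- single reflexive model in which S sees T iff the antecedent of T contains φ for
-- every □ φ in the antecedent of S.
module Submission where

open import Defs
open import Data.Empty using (⊥-elim)
open import Data.List.Base using (List; []; _∷_; [_]; _++_; concatMap; map)
open import Data.List.Extrema.Nat using (max; xs≤max)
open import Data.List.NonEmpty using (_∷_; _++⁺_; toList)
open import Data.List.Membership.Propositional using (_∈_; find; lose)
open import Data.List.Membership.Propositional.Properties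
  using (∈-++⁺ˡ; ∈-++⁺ʳ; ∈-++⁻; ∈-map⁺; ∈-concatMap⁺)
open import Data.List.Properties using (++-assoc; ++-identityʳ)
open import Data.List.Relation.Binary.Pointwise as Pointwise using (Pointwise; []; _∷_)
open import Data.List.Relation.Unary.All as All using (All; []; _∷_)
import Data.List.Relation.Unary.All.Properties as All
open import Data.List.Relation.Unary.Any using (Any; here; there; any?)
open import Data.List.Relation.Unary.Linked using (Linked; []; [-]; _∷_)
open import Data.Nat.Base using (ℕ; zero; suc; _⊔_; _≤_; s≤s⁻¹)
open import Data.Nat.Properties
  using (_≟_; m⊔n≤o⇒m≤o; m⊔n≤o⇒n≤o; ≤-trans; n≤1+n)
open import Data.Product.Base using (∃; ∃-syntax; _×_; _,_; proj₁)
open import Data.Sum.Base using (_⊎_; inj₁; inj₂; map₁; map₂)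
open import Data.Unit.Base using (⊤; tt)
open import Function.Base using (id; _∘_)
open import Function.Bundles using (Equivalence; mk⇔)
open import Relation.Binary.PropositionalEquality using (_≡_; refl; sym; subst; cong)
open import Relation.Nullary.Decidable using (Dec; yes; no; map′)
open import Relation.Nullary.Negation.Core using (¬_)

open Sequent

private
  variable
    S T U X Y : Sequent
    Γ Δ       : List Formula
    φ ψ       : Formula
    G H K     : Hypersequent
    Ss Ts     : List Sequent

-- Signed formulas

data Signed : Set where
  true false : Formula → Signed

infixr 5 _⊕_
infix  3 _∈ˢ_ _⊆ˢ_

_⊕_ : Signed → Sequent → Sequent
true  φ ⊕ (Γ ⇒ Δ) = φ ∷ Γ ⇒ Δ
false φ ⊕ (Γ ⇒ Δ) = Γ ⇒ φ ∷ Δ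

_∈ˢ_ : Signed → Sequent → Set
true  φ ∈ˢ S = φ ∈ antecedent S
false φ ∈ˢ S = φ ∈ succedent S

record _⊆ˢ_ (S T : Sequent) : Set where
  constructor ⊆-by
  field
    member : ∀ s → s ∈ˢ S → s ∈ˢ T

open _⊆ˢ_

⊆-refl : S ⊆ˢ S
⊆-refl = ⊆-by λ _ → id

⊆-trans : S ⊆ˢ T → T ⊆ˢ U → S ⊆ˢ U
⊆-trans p q = ⊆-by λ s → member q s ∘ member p s

∈-⊕ˡ : ∀ s → s ∈ˢ s ⊕ S
∈-⊕ˡ (true  _) = here refl
∈-⊕ˡ (false _) = here refl

∈-⊕ʳ : ∀ s t → s ∈ˢ S → s ∈ˢ t ⊕ S
∈-⊕ʳ (true  _) (true  _) = there
∈-⊕ʳ (true  _) (false _) = id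
∈-⊕ʳ (false _) (true  _) = id
∈-⊕ʳ (false _) (false _) = there

∈-⊕⁻ : ∀ s t → s ∈ˢ t ⊕ S → s ≡ t ⊎ s ∈ˢ S
∈-⊕⁻ (true  _) (true  _) (here refl) = inj₁ refl
∈-⊕⁻ (true  _) (true  _) (there p)   = inj₂ p
∈-⊕⁻ (true  _) (false _) p           = inj₂ p
∈-⊕⁻ (false _) (true  _) p           = inj₂ p
∈-⊕⁻ (false _) (false _) (here refl) = inj₁ refl
∈-⊕⁻ (false _) (false _) (there p)   = inj₂ p

⊆-⊕ : ∀ s → S ⊆ˢ s ⊕ S
⊆-⊕ s = ⊆-by λ t → ∈-⊕ʳ t s

⊕-⊆ : ∀ s → s ∈ˢ T → S ⊆ˢ T → s ⊕ S ⊆ˢ T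
⊕-⊆ {T} s s∈T S⊆T = ⊆-by λ t t∈ → case-⊕ t (∈-⊕⁻ t s t∈)
  where
  case-⊕ : ∀ t → t ≡ s ⊎ t ∈ˢ _ → t ∈ˢ T
  case-⊕ t (inj₁ refl) = s∈T
  case-⊕ t (inj₂ p)    = member S⊆T t p

-- Equality of hypersequents

⊆-antisym : S ⊆ˢ T → T ⊆ˢ S → S ≈ˢ T
⊆-antisym p q = record
  { antecedent-≈ = mk⇔ (member p (true _)) (member q (true _))
  ; succedent-≈  = mk⇔ (member p (false _)) (member q (false _))
  }

≈⇒⊆ : S ≈ˢ T → S ⊆ˢ T
≈⇒⊆ p = ⊆-by λ
  { (true  _) → Equivalence.to (_≈ˢ_.antecedent-≈ p)
  ; (false _) → Equivalence.to (_≈ˢ_.succedent-≈ p) }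

≈⇒⊇ : S ≈ˢ T → T ⊆ˢ S
≈⇒⊇ p = ⊆-by λ
  { (true  _) → Equivalence.from (_≈ˢ_.antecedent-≈ p)
  ; (false _) → Equivalence.from (_≈ˢ_.succedent-≈ p) }

≈ˢ-refl : S ≈ˢ S
≈ˢ-refl = ⊆-antisym ⊆-refl ⊆-refl

≈ˢ-trans : S ≈ˢ T → T ≈ˢ U → S ≈ˢ U
≈ˢ-trans p q = ⊆-antisym (⊆-trans (≈⇒⊆ p) (≈⇒⊆ q)) (⊆-trans (≈⇒⊇ q) (≈⇒⊇ p))

≈-refl : Pointwise _≈ˢ_ Ss Ss
≈-refl = Pointwise.refl ≈ˢ-refl

≈-context : ∀ Ss → S ≈ˢ T → (Ss ++⁺ (S ∷ Ts)) ≈ʰ (Ss ++⁺ (T ∷ Ts))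
≈-context []       S≈T = S≈T ∷ ≈-refl
≈-context (_ ∷ Ss) S≈T = ≈ˢ-refl ∷ ≈-context Ss S≈T

-- Since sequents are sets, a principal formula already in `S` vanishes into it. This turns each
-- logical rule into a cumulative one whose premise keeps all of `S`.
⊕-absorb : ∀ s → s ∈ˢ S → s ⊕ S ≈ˢ S
⊕-absorb s s∈S = ⊆-antisym (⊕-⊆ s s∈S ⊆-refl) (⊆-⊕ s)

-- Cut-free derivability

infix 3 ⊢_

⊢_ : Hypersequent → Set
⊢ H = ∃ λ (d : Derivation RT H) → CutFree d

⊢-resp-≈ : G ≈ʰ H → ⊢ G → ⊢ H
⊢-resp-≈ G≈H (infer r ds C≈G , cf) = infer r ds (Pointwise.transitive ≈ˢ-trans C≈G G≈H) , cf

⊢-resp-toList : toList G ≡ toList H → ⊢ G → ⊢ H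
⊢-resp-toList {G} eq = ⊢-resp-≈ (subst (Pointwise _≈ˢ_ (toList G)) eq ≈-refl)

infer₁ : (r : RT [ G ] H) → ¬ IsCut r → H ≈ʰ K → ⊢ G → ⊢ K
infer₁ r nc H≈K (d , cf) = infer r (d ∷ []) H≈K , nc , cf , tt

weakenˡ : ∀ Ss Φ → ⊢ Ss ++⁺ ((Γ ⇒ Δ) ∷ Ts) → ⊢ Ss ++⁺ ((Φ ++ Γ ⇒ Δ) ∷ Ts)
weakenˡ Ss []      D = D
weakenˡ Ss (φ ∷ Φ) D = infer₁ (rk (WL Ss _ _ _ φ)) (λ ()) ≈-refl (weakenˡ Ss Φ D)

weakenʳ : ∀ Ss Φ → ⊢ Ss ++⁺ ((Γ ⇒ Δ) ∷ Ts) → ⊢ Ss ++⁺ ((Γ ⇒ Φ ++ Δ) ∷ Ts)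
weakenʳ Ss []      D = D
weakenʳ Ss (φ ∷ Φ) D = infer₁ (rk (WR Ss _ _ _ φ)) (λ ()) ≈-refl (weakenʳ Ss Φ D)

-- Weakening by every formula of `T` yields the union of `T` and `S`, which as a set is `T`.
weaken : ∀ Ss → S ⊆ˢ T → ⊢ Ss ++⁺ (S ∷ Ts) → ⊢ Ss ++⁺ (T ∷ Ts)
weaken {Γ ⇒ Δ} {Λ ⇒ Θ} Ss S⊆T =
  ⊢-resp-≈ (≈-context Ss (⊆-antisym (⊆-by into) (⊆-by from))) ∘ weakenʳ Ss Θ ∘ weakenˡ Ss Λ
  where
  absorb : ∀ {Φ Ψ : List Formula} → (φ ∈ Φ → φ ∈ Ψ) → φ ∈ Ψ ++ Φ → φ ∈ Ψ
  absorb {Ψ = Ψ} Φ⊆Ψ p with ∈-++⁻ Ψ p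
  ... | inj₁ q = q
  ... | inj₂ q = Φ⊆Ψ q

  into : ∀ s → s ∈ˢ (Λ ++ Γ ⇒ Θ ++ Δ) → s ∈ˢ (Λ ⇒ Θ)
  into (true  φ) = absorb (member S⊆T (true φ))
  into (false φ) = absorb (member S⊆T (false φ))

  from : ∀ s → s ∈ˢ (Λ ⇒ Θ) → s ∈ˢ (Λ ++ Γ ⇒ Θ ++ Δ)
  from (true  _) = ∈-++⁺ˡ
  from (false _) = ∈-++⁺ˡ

[]-⊆ : [] ⇒ [] ⊆ˢ S
[]-⊆ = ⊆-by λ { (true _) () ; (false _) () }

prepend : ⊢ T ∷ Ts → ⊢ S ∷ T ∷ Ts
prepend D = weaken [] []-⊆ (infer₁ (rk (EWL _)) (λ ()) ≈-refl D)

append : ∀ Ts → ⊢ S ∷ Ss → ⊢ S ∷ (Ss ++ Ts)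
append {S} {Ss} []       = subst (λ Us → ⊢ S ∷ Us) (sym (++-identityʳ Ss))
append {S} {Ss} (T ∷ Ts) =
    subst (λ Us → ⊢ S ∷ Us) (++-assoc Ss [ T ] Ts)
  ∘ append Ts
  ∘ ⊢-resp-toList (snoc T)
  ∘ weaken (S ∷ Ss) []-⊆
  ∘ ⊢-resp-toList (sym (snoc ([] ⇒ [])))
  ∘ infer₁ (rk (EWR _)) (λ ()) ≈-refl
  where
  snoc : ∀ U → toList ((S ∷ Ss) ++⁺ (U ∷ [])) ≡ S ∷ (Ss ++ [ U ])
  snoc U = cong (S ∷_) (go Ss)
    where
    go : ∀ Us → toList (Us ++⁺ (U ∷ [])) ≡ Us ++ [ U ]
    go []       = refl
    go (V ∷ Us) = cong (V ∷_) (go Us)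

⊢-axiom : true φ ∈ˢ S → false φ ∈ˢ S → ⊢ S ∷ Ss
⊢-axiom {φ} {S} {Ss} p q =
  append Ss (weaken [] (⊕-⊆ (true φ) p (⊕-⊆ (false φ) q []-⊆))
                       (infer (rk (Ax φ)) [] ≈-refl , (λ ()) , tt))

⊢-¬L : true (~ φ) ∈ˢ S → ⊢ (false φ ⊕ S) ∷ Ss → ⊢ S ∷ Ss
⊢-¬L p = infer₁ (rk (¬L [] _ _ _ _)) (λ ()) (⊕-absorb (true _) p ∷ ≈-refl)

⊢-¬R : false (~ φ) ∈ˢ S → ⊢ (true φ ⊕ S) ∷ Ss → ⊢ S ∷ Ss
⊢-¬R p = infer₁ (rk (¬R [] _ _ _ _)) (λ ()) (⊕-absorb (false _) p ∷ ≈-refl)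

⊢-∧L : true (φ ∧ ψ) ∈ˢ S → ⊢ (true φ ⊕ true ψ ⊕ S) ∷ Ss → ⊢ S ∷ Ss
⊢-∧L p =
    infer₁ (rk (∧L₂ [] _ _ _ _ _)) (λ ()) (⊕-absorb (true _) p ∷ ≈-refl)
  ∘ infer₁ (rk (∧L₁ [] _ _ _ _ _)) (λ ()) (⊕-absorb (true _) (there p) ∷ ≈-refl)

⊢-∧R : false (φ ∧ ψ) ∈ˢ S → ⊢ (false φ ⊕ S) ∷ Ss → ⊢ (false ψ ⊕ S) ∷ Ss → ⊢ S ∷ Ss
⊢-∧R p (d , cf) (e , cf′) =
    infer (rk (∧R [] _ _ _ _ _)) (d ∷ e ∷ []) (⊕-absorb (false _) p ∷ ≈-refl)
  , (λ ()) , cf , cf′ , tt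

⊢-□L : true (□ φ) ∈ˢ S → ⊢ S ∷ (true φ ⊕ T) ∷ Ss → ⊢ S ∷ T ∷ Ss
⊢-□L p = infer₁ (rk (□L [] _ _ _ _ _ _)) (λ ()) (⊕-absorb (true _) p ∷ ≈-refl)

-- Read from premise to conclusion: a copy of `S` goes in front, `□L` removes `φ` from the second
-- component, and `EC` merges the two equal components.
⊢-□L-reflexive : true (□ φ) ∈ˢ S → ⊢ (true φ ⊕ S) ∷ Ss → ⊢ S ∷ Ss
⊢-□L-reflexive p = infer₁ (EC [] _ _ _) (λ ()) ≈-refl ∘ ⊢-□L p ∘ prepend

-- Passing boxed formulas on to the next component

unbox : List Formula → List Formula
unbox []            = []
unbox (□ φ ∷ Γ)     = φ ∷ unbox Γ
unbox (var _ ∷ Γ)   = unbox Γ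
unbox (~ _ ∷ Γ)     = unbox Γ
unbox (_ ∧ _ ∷ Γ)   = unbox Γ

∈-unbox⁺ : □ φ ∈ Γ → φ ∈ unbox Γ
∈-unbox⁺ {Γ = □ _ ∷ _}   (here refl) = here refl
∈-unbox⁺ {Γ = □ _ ∷ _}   (there p)   = there (∈-unbox⁺ p)
∈-unbox⁺ {Γ = var _ ∷ _} (there p)   = ∈-unbox⁺ p
∈-unbox⁺ {Γ = ~ _ ∷ _}   (there p)   = ∈-unbox⁺ p
∈-unbox⁺ {Γ = _ ∧ _ ∷ _} (there p)   = ∈-unbox⁺ p

∈-unbox⁻ : φ ∈ unbox Γ → □ φ ∈ Γ
∈-unbox⁻ {Γ = □ _ ∷ _}   (here refl) = here refl
∈-unbox⁻ {Γ = □ _ ∷ _}   (there p)   = there (∈-unbox⁻ p)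
∈-unbox⁻ {Γ = var _ ∷ _} p           = there (∈-unbox⁻ p)
∈-unbox⁻ {Γ = ~ _ ∷ _}   p           = there (∈-unbox⁻ p)
∈-unbox⁻ {Γ = _ ∧ _ ∷ _} p           = there (∈-unbox⁻ p)

successor : Sequent → Sequent → Sequent
successor S (Λ ⇒ Θ) = unbox (antecedent S) ++ Λ ⇒ Θ

⊆-successor : T ⊆ˢ successor S T
⊆-successor {S = S} = ⊆-by λ { (true _) → ∈-++⁺ʳ (unbox (antecedent S)) ; (false _) → id }

⊢-successor : ⊢ successor S T ∷ Ss → ⊢ S ∷ T ∷ Ss
⊢-successor {S} {Λ ⇒ Θ} {Ss} = release (unbox (antecedent S)) ∈-unbox⁻ ∘ prepend
  where
  release : ∀ Φ → (∀ {φ} → φ ∈ Φ → □ φ ∈ antecedent S) →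
            ⊢ S ∷ (Φ ++ Λ ⇒ Θ) ∷ Ss → ⊢ S ∷ (Λ ⇒ Θ) ∷ Ss
  release []      _ = id
  release (φ ∷ Φ) b = release Φ (b ∘ there) ∘ ⊢-□L (b (here refl))

-- `□R` acts on the rightmost component only, so `S` is derived alone and `Ss` is appended
-- afterwards.
⊢-□R : false (□ ψ) ∈ˢ S → ⊢ successor S ([] ⇒ [ ψ ]) ∷ [] → ⊢ S ∷ Ss
⊢-□R {Ss = Ss} p =
    append Ss
  ∘ infer₁ (rk (□R [] _ _ _)) (λ ()) (⊕-absorb (false _) p ∷ ≈-refl)
  ∘ ⊢-successor

-- The model of saturated sequents

-- A true `□ φ` asks for `φ` in the same sequent, which will make the model reflexive. A false `□ φ`
-- asks for nothing here, as its witness is another world.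
Decomposed : Signed → Sequent → Set
Decomposed (true  (var _)) S = ⊤
Decomposed (false (var _)) S = ⊤
Decomposed (true  (~ φ))   S = false φ ∈ˢ S
Decomposed (false (~ φ))   S = true φ ∈ˢ S
Decomposed (true  (φ ∧ ψ)) S = true φ ∈ˢ S × true ψ ∈ˢ S
Decomposed (false (φ ∧ ψ)) S = false φ ∈ˢ S ⊎ false ψ ∈ˢ S
Decomposed (true  (□ φ))   S = true φ ∈ˢ S
Decomposed (false (□ φ))   S = ⊤

Decomposed-mono : ∀ s → S ⊆ˢ T → Decomposed s S → Decomposed s T
Decomposed-mono (true  (var _)) S⊆T _              = tt
Decomposed-mono (false (var _)) S⊆T _              = tt
Decomposed-mono (true  (~ φ))   S⊆T p              = member S⊆T (false φ) p
Decomposed-mono (false (~ φ))   S⊆T p              = member S⊆T (true φ) p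
Decomposed-mono (true  (φ ∧ ψ)) S⊆T (p , q)        = member S⊆T (true φ) p , member S⊆T (true ψ) q
Decomposed-mono (false (φ ∧ ψ)) S⊆T (inj₁ p)       = inj₁ (member S⊆T (false φ) p)
Decomposed-mono (false (φ ∧ ψ)) S⊆T (inj₂ q)       = inj₂ (member S⊆T (false ψ) q)
Decomposed-mono (true  (□ φ))   S⊆T p              = member S⊆T (true φ) p
Decomposed-mono (false (□ φ))   S⊆T _              = tt

Saturated : Sequent → Set
Saturated S = ∀ s → s ∈ˢ S → Decomposed s S

-- Variables suffice: in a saturated sequent, compound formulas are reduced to their parts or to
-- witnesses at other worlds.
Clash : Sequent → Set
Clash S = ∃[ p ] true (var p) ∈ˢ S × false (var p) ∈ˢ S

Sees : Sequent → Sequent → Set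
Sees S T = ∀ {φ} → true (□ φ) ∈ˢ S → true φ ∈ˢ T

-- Inductive, so a proof is a well-founded tree of witnesses, and each sequent occurring in it is
-- again a world.
data Refuted (S : Sequent) : Set where
  refuted : Saturated S → ¬ Clash S →
            (∀ {ψ} → false (□ ψ) ∈ˢ S → ∃[ T ] Sees S T × false ψ ∈ˢ T × Refuted T) →
            Refuted S

𝓜 : Model
𝓜 = record
  { frame = record
    { World     = ∃ Refuted
    ; inhabited = ([] ⇒ []) , refuted (λ { (true _) () ; (false _) () }) (λ { (_ , () , _) }) (λ ())
    ; _⟶_       = λ { (S , _) (T , _) → Sees S T }
    }
  ; valuation = λ { p (S , _) → true (var p) ∈ˢ S }
  }

-- Saturation at true boxed formulas is exactly `Sees S S`.
𝓜-reflexive : ReflexiveFrame (Model.frame 𝓜)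
𝓜-reflexive {_ , refuted sat _ _} p = sat (true (□ _)) p

mutual
  -- Structural recursion on the formula, simultaneous with `falsity` because negation exchanges the
  -- two.
  truth : ∀ φ (w : ∃ Refuted) → true φ ∈ˢ proj₁ w → 𝓜 , w ⊨ φ
  truth (var _) w p = p
  truth (~ φ)   w@(_ , refuted sat _ _) p = falsity φ w (sat (true (~ φ)) p)
  truth (φ ∧ ψ) w@(_ , refuted sat _ _) p with sat (true (φ ∧ ψ)) p
  ... | q , r = truth φ w q , truth ψ w r
  truth (□ φ)   w p v w⟶v = truth φ v (w⟶v p)

  falsity : ∀ φ (w : ∃ Refuted) → false φ ∈ˢ proj₁ w → 𝓜 , w ⊭ φ
  falsity (var _) (_ , refuted _ open′ _) p q = open′ (_ , q , p)
  falsity (~ φ)   w@(_ , refuted sat _ _) p ¬φ = ¬φ (truth φ w (sat (false (~ φ)) p))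
  falsity (φ ∧ ψ) w@(_ , refuted sat _ _) p (x , y) with sat (false (φ ∧ ψ)) p
  ... | inj₁ q = falsity φ w q x
  ... | inj₂ q = falsity ψ w q y
  falsity (□ φ)   (_ , refuted _ _ witness) p □φ with witness p
  ... | T , S⟶T , q , r = falsity φ (T , r) q (□φ (T , r) S⟶T)

-- Inclusion rather than equality, because the worlds found are saturated extensions of the
-- components.
Refutable : Hypersequent → Set
Refutable H = ∃[ ws ] Linked (Model._⟶_ 𝓜) ws × Pointwise (λ w S → S ⊆ˢ proj₁ w) ws (toList H)

refutable⇒counterExample : Refutable H → IsCounterExample 𝓜 H
refutable⇒counterExample (ws , linked , ps) = ws , linked , Pointwise.map (λ {w} → countermodel w) ps
  where
  countermodel : ∀ w → S ⊆ˢ proj₁ w → IsCountermodel 𝓜 w S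
  countermodel w p =
      All.tabulate (λ {φ} → truth φ w ∘ member p (true φ))
    , All.tabulate (λ {φ} → falsity φ w ∘ member p (false φ))

-- Saturation

modalDepth : Formula → ℕ
modalDepth (var _) = 0
modalDepth (~ φ)   = modalDepth φ
modalDepth (φ ∧ ψ) = modalDepth φ ⊔ modalDepth ψ
modalDepth (□ φ)   = suc (modalDepth φ)

formula : Signed → Formula
formula (true  φ) = φ
formula (false φ) = φ

Bounded : ℕ → Sequent → Set
Bounded d S = ∀ s → s ∈ˢ S → modalDepth (formula s) ≤ d

-- `Goal` stands for a refutation of the initial hypersequent. It stays fixed while the leftmost
-- component grows, and saturation merely passes it on.
module Saturation (d : ℕ) (Ss : List Sequent) (Goal : Set) where

  Outcome : Sequent → Set
  Outcome S = (⊢ S ∷ Ss) ⊎ Goal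

  -- X is the part of S that has been decomposed so far.
  record Stage (X S : Sequent) : Set where
    field
      included  : X ⊆ˢ S
      saturated : Saturated X
      bounded   : Bounded d X

  open Stage public

  enlarge : S ⊆ˢ T → Stage X S → Stage X T
  enlarge S⊆T st = record
    { included = ⊆-trans (included st) S⊆T ; saturated = saturated st ; bounded = bounded st }

  extend : ∀ s → s ∈ˢ S → modalDepth (formula s) ≤ d → Decomposed s X →
           Stage X S → Stage (s ⊕ X) S
  extend {X = X} s s∈S s≤d dec st = record
    { included  = ⊕-⊆ s s∈S (included st)
    ; saturated = λ t t∈ → Decomposed-mono t (⊆-⊕ s) (decomposed t (∈-⊕⁻ t s t∈))
    ; bounded   = λ t t∈ → depth t (∈-⊕⁻ t s t∈)
    }
    where
    decomposed : ∀ t → t ≡ s ⊎ t ∈ˢ X → Decomposed t X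
    decomposed t (inj₁ refl) = dec
    decomposed t (inj₂ p)    = saturated st t p
    depth : ∀ t → t ≡ s ⊎ t ∈ˢ X → modalDepth (formula t) ≤ d
    depth t (inj₁ refl) = s≤d
    depth t (inj₂ p)    = bounded st t p

  -- All work still to be done after the current formula. Passing it as an argument leaves
  -- `decompose` structurally recursive on formulas and lets both branches of `∧R` resume it.
  Continuation : (Sequent → Set) → Sequent → Sequent → Set
  Continuation P X S = ∀ {X′ S′} → X ⊆ˢ X′ → S ⊆ˢ S′ → Stage X′ S′ → P X′ → Outcome S′

  decompose : ∀ s → modalDepth (formula s) ≤ d → s ∈ˢ S → Stage X S →
              Continuation (s ∈ˢ_) X S → Outcome S

  -- `s` joins the decomposed part only once its parts are there, so that part is saturated at every
  -- stage.
  finish : ∀ s → modalDepth (formula s) ≤ d → s ∈ˢ S → Continuation (s ∈ˢ_) X S →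
           X ⊆ˢ Y → S ⊆ˢ T → Stage Y T → Decomposed s Y → Outcome T
  finish s s≤d s∈S k X⊆Y S⊆T st dec =
    k (⊆-trans X⊆Y (⊆-⊕ s)) S⊆T (extend s (member S⊆T s s∈S) s≤d dec st) (∈-⊕ˡ s)

  -- The pattern shared by all cases in which decomposing a single subformula `t` suffices for `s`.
  descend : ∀ s t → modalDepth (formula t) ≤ d → modalDepth (formula s) ≤ d → s ∈ˢ S →
            (∀ {Y} → t ∈ˢ Y → Decomposed s Y) → Stage X S →
            Continuation (s ∈ˢ_) X S →
            (∀ {X} → Stage X (t ⊕ S) → Continuation (t ∈ˢ_) X (t ⊕ S) → Outcome (t ⊕ S)) →
            Outcome (t ⊕ S)
  descend s t t≤d s≤d s∈S dec st k rec =
    rec (enlarge (⊆-⊕ t) st)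
        λ X⊆Y S⊆T st′ t∈Y → finish s s≤d s∈S k X⊆Y (⊆-trans (⊆-⊕ t) S⊆T) st′ (dec t∈Y)

  decompose s@(true (var _)) s≤d p st k = finish s s≤d p k ⊆-refl ⊆-refl st tt
  decompose s@(false (var _)) s≤d p st k = finish s s≤d p k ⊆-refl ⊆-refl st tt
  decompose s@(false (□ _)) s≤d p st k = finish s s≤d p k ⊆-refl ⊆-refl st tt
  decompose s@(true (~ φ)) s≤d p st k = map₁ (⊢-¬L p)
    (descend s (false φ) s≤d s≤d p id st k (decompose (false φ) s≤d (here refl)))
  decompose s@(false (~ φ)) s≤d p st k = map₁ (⊢-¬R p)
    (descend s (true φ) s≤d s≤d p id st k (decompose (true φ) s≤d (here refl)))
  decompose s@(true (□ φ)) s≤d p st k = map₁ (⊢-□L-reflexive p)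
    (descend s (true φ) φ≤d s≤d p id st k (decompose (true φ) φ≤d (here refl)))
    where φ≤d = ≤-trans (n≤1+n _) s≤d
  decompose s@(true (φ ∧ ψ)) s≤d p st k = map₁ (⊢-∧L p)
    (decompose (true φ) (m⊔n≤o⇒m≤o (modalDepth φ) _ s≤d) (here refl)
      (enlarge (⊆-trans (⊆-⊕ (true ψ)) (⊆-⊕ (true φ))) st)
      λ X⊆Y S⊆T st′ φ∈Y →
        -- `ψ` is treated inside the continuation of `φ`, so both end up in the final decomposed
        -- part.
        decompose (true ψ) (m⊔n≤o⇒n≤o (modalDepth φ) _ s≤d) (member S⊆T (true ψ) (there (here refl))) st′
          λ Y⊆Z T⊆U st″ ψ∈Z →
            finish s s≤d p k (⊆-trans X⊆Y Y⊆Z)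
              (⊆-trans (⊆-trans (⊆-⊕ (true ψ)) (⊆-⊕ (true φ))) (⊆-trans S⊆T T⊆U))
              st″ (member Y⊆Z (true φ) φ∈Y , ψ∈Z))
  decompose s@(false (φ ∧ ψ)) s≤d p st k
    with descend s (false φ) φ≤d s≤d p inj₁ st k (decompose (false φ) φ≤d (here refl))
       | descend s (false ψ) ψ≤d s≤d p inj₂ st k (decompose (false ψ) ψ≤d (here refl))
    where
    φ≤d = m⊔n≤o⇒m≤o (modalDepth φ) _ s≤d
    ψ≤d = m⊔n≤o⇒n≤o (modalDepth φ) _ s≤d
  ... | inj₁ D | inj₁ E = inj₁ (⊢-∧R p D E)
  ... | inj₂ g | _      = inj₂ g
  ... | inj₁ _ | inj₂ g = inj₂ g

  decomposeAll : ∀ ss → All (λ s → modalDepth (formula s) ≤ d × s ∈ˢ S) ss → Stage X S →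
                 Continuation (λ Y → All (_∈ˢ Y) ss) X S → Outcome S
  decomposeAll []       []                st k = k ⊆-refl ⊆-refl st []
  decomposeAll (s ∷ ss) ((s≤d , p) ∷ ps) st k =
    decompose s s≤d p st λ X⊆Y S⊆T st′ s∈Y →
      decomposeAll ss (All.map (λ { {t} (t≤d , q) → t≤d , member S⊆T t q }) ps) st′
        λ Y⊆Z T⊆U st″ ss⊆Z →
          k (⊆-trans X⊆Y Y⊆Z) (⊆-trans S⊆T T⊆U) st″ (member Y⊆Z s s∈Y ∷ ss⊆Z)

  members : Sequent → List Signed
  members (Γ ⇒ Δ) = map true Γ ++ map false Δ

  ∈-members : ∀ s → s ∈ˢ S → s ∈ members S
  ∈-members (true  _)     p = ∈-++⁺ˡ (∈-map⁺ true p)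
  ∈-members {S} (false _) p = ∈-++⁺ʳ (map true (antecedent S)) (∈-map⁺ false p)

  saturate : Bounded d S →
             (∀ {X} → S ⊆ˢ X → Saturated X → Bounded d X → Outcome X) → Outcome S
  saturate {S} bd k =
    decomposeAll (members S)
      (All.++⁺ (All.map⁺ (All.tabulate λ p → bd (true _) p , p))
               (All.map⁺ (All.tabulate λ p → bd (false _) p , p)))
      (record { included = []-⊆ ; saturated = λ { (true _) () ; (false _) () }
              ; bounded = λ { (true _) () ; (false _) () } })
      -- The search goes on with the decomposed part `X`, which is saturated and contains `S`. A
      -- derivation for `X` is weakened to the full component.
      λ _ _ st ps → map₁ (weaken [] (included st))
        (k (⊆-by λ s → All.lookup ps ∘ ∈-members s) (saturated st) (bounded st))

-- Clashes, finite choice and depth bounds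

var∈? : ∀ p Γ → Dec (var p ∈ Γ)
var∈? p = any? λ
  { (var q) → map′ (cong var) (λ { refl → refl }) (p ≟ q)
  ; (~ _)   → no λ ()
  ; (_ ∧ _) → no λ ()
  ; (□ _)   → no λ () }

clash? : ∀ S → Dec (Clash S)
clash? (Γ ⇒ Δ) = map′ to from (any? clashing? Γ)
  where
  Clashing : Formula → Set
  Clashing φ = ∃[ p ] φ ≡ var p × var p ∈ Δ

  clashing? : ∀ φ → Dec (Clashing φ)
  clashing? (var p) = map′ (λ q → p , refl , q) (λ { (_ , refl , q) → q }) (var∈? p Δ)
  clashing? (~ _)   = no λ { (_ , () , _) }
  clashing? (_ ∧ _) = no λ { (_ , () , _) }
  clashing? (□ _)   = no λ { (_ , () , _) }

  to : Any Clashing Γ → Clash (Γ ⇒ Δ)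
  to a with find a
  ... | _ , q , p , refl , r = p , q , r

  from : Clash (Γ ⇒ Δ) → Any Clashing Γ
  from (p , q , r) = lose q (p , refl , r)

-- Finite choice: it collects a witness for each false boxed formula unless one of them yields a
-- derivation.
sequence : ∀ {A B : Set} {P : A → Set} xs → (∀ {x} → x ∈ xs → B ⊎ P x) → B ⊎ (∀ {x} → x ∈ xs → P x)
sequence []       f = inj₂ λ ()
sequence (x ∷ xs) f with f (here refl) | sequence xs (f ∘ there)
... | inj₁ b | _      = inj₁ b
... | inj₂ _ | inj₁ b = inj₁ b
... | inj₂ p | inj₂ g = inj₂ λ { (here refl) → p ; (there q) → g q }

-- Bounding `φ` rather than `□ φ` serves both uses: the bound drops for a witness and is kept for
-- the next component.
successor-bounded : ∀ {d} → (∀ {φ} → true (□ φ) ∈ˢ S → modalDepth φ ≤ d) → Bounded d T →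
                    Bounded d (successor S T)
successor-bounded {S} bS bT (true φ) p with ∈-++⁻ (unbox (antecedent S)) p
... | inj₁ q = bS (∈-unbox⁻ q)
... | inj₂ q = bT (true φ) q
successor-bounded bS bT (false φ) p = bT (false φ) p

bound : ∀ Ss → ∃[ d ] All (Bounded d) Ss
bound Ss = d , All.tabulate λ {S} S∈ → λ
  { (true  _) p → below S∈ (∈-++⁺ˡ p)
  ; (false _) p → below S∈ (∈-++⁺ʳ (antecedent S) p) }
  where
  formulas : Sequent → List Formula
  formulas (Γ ⇒ Δ) = Γ ++ Δ

  depths : List ℕ
  depths = map modalDepth (concatMap formulas Ss)

  d : ℕ
  d = max 0 depths

  below : S ∈ Ss → φ ∈ formulas S → modalDepth φ ≤ d
  below S∈ p =
    All.lookup (xs≤max 0 depths) (∈-map⁺ modalDepth (∈-concatMap⁺ formulas (lose S∈ p)))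

-- Search for a derivation or a refutation

mutual
  -- Terminates lexicographically in `d` and `Ss`: a box witness lowers `d`, and moving to the next
  -- component shortens `Ss`.
  decide : ∀ d S Ss → Bounded d S → All (Bounded d) Ss → (⊢ S ∷ Ss) ⊎ Refutable (S ∷ Ss)
  decide d S Ss bd bds =
    saturate bd λ {X} S⊆X sat bdX → map₂ (shrink S⊆X) (decideSaturated d X Ss sat bdX bds)
    where
    open Saturation d Ss (Refutable (S ∷ Ss))
    shrink : S ⊆ˢ X → Refutable (X ∷ Ss) → Refutable (S ∷ Ss)
    shrink S⊆X (ws , linked , p ∷ ps) = ws , linked , ⊆-trans S⊆X p ∷ ps

  decideSaturated : ∀ d X Ss → Saturated X → Bounded d X → All (Bounded d) Ss →
                    (⊢ X ∷ Ss) ⊎ Refutable (X ∷ Ss)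
  decideSaturated d X Ss sat bd bds with clash? X
  ... | yes (_ , p , q) = inj₁ (⊢-axiom p q)
  ... | no open′ with sequence (unbox (succedent X))
                         (λ p → map₁ (⊢-□R (∈-unbox⁻ p)) (decideBox d X _ bd (∈-unbox⁻ p)))
  ...   | inj₁ D = inj₁ D
  ...   | inj₂ witness = decideRest d X Ss (refuted sat open′ (witness ∘ ∈-unbox⁺)) bd bds

  decideBox : ∀ d X ψ → Bounded d X → false (□ ψ) ∈ˢ X →
              (⊢ successor X ([] ⇒ [ ψ ]) ∷ []) ⊎ (∃[ T ] Sees X T × false ψ ∈ˢ T × Refuted T)
  -- A boxed formula has depth at least one.
  decideBox zero X ψ bd p with () ← bd (false (□ ψ)) p
  decideBox (suc d) X ψ bd p 
    with decide d (successor X ([] ⇒ [ ψ ])) []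
           (successor-bounded {S = X} (λ q → s≤s⁻¹ (bd (true _) q))
             λ { (false _) (here refl) → s≤s⁻¹ (bd (false _) p) }) []
  ... | inj₁ D = inj₁ D
  ... | inj₂ ((T , r) ∷ [] , _ , q ∷ []) =
    inj₂ (T , (λ b → member q (true _) (∈-++⁺ˡ (∈-unbox⁺ b))) , member q (false ψ) (here refl) , r)

  -- `X` is already a world whatever follows it, so only a path for `Ss` starting at a world seen by
  -- `X` is missing.
  decideRest : ∀ d X Ss → Refuted X → Bounded d X → All (Bounded d) Ss →
               (⊢ X ∷ Ss) ⊎ Refutable (X ∷ Ss)
  decideRest d X []       r bd []         = inj₂ ((X , r) ∷ [] , [-] , ⊆-refl ∷ [])
  decideRest d X (S ∷ Ss) r bd (b ∷ bds)
    with decide d (successor X S) Ss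
           (successor-bounded {S = X} (λ q → ≤-trans (n≤1+n _) (bd (true _) q)) b) bds
  ... | inj₁ D = inj₁ (⊢-successor D)
  -- `w` contains `successor X S`, hence is seen by `X` and contains `S`.
  ... | inj₂ (w ∷ ws , linked , p ∷ ps) =
    inj₂ ((X , r) ∷ w ∷ ws
         , (λ b → member p (true _) (∈-++⁺ˡ (∈-unbox⁺ b))) ∷ linked
         , ⊆-refl ∷ ⊆-trans (⊆-successor {S = X}) p ∷ ps)

mainTheorem2 : (H : Hypersequent) →
    ((M : Model) → ReflexiveFrame (Model.frame M) → ¬ IsCounterExample M H) →
    ∃ λ (d : Derivation RT H) → CutFree d
mainTheorem2 (S ∷ Ss) valid with bound (S ∷ Ss)
... | d , b ∷ bs with decide d S Ss b bs
...   | inj₁ D = D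
...   | inj₂ c = ⊥-elim (valid 𝓜 (λ {w} → 𝓜-reflexive {w}) (refutable⇒counterExample {S ∷ Ss} c))
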